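{- There is a Heyting-valued structure in which the rule $$(\Omega_0\ \mathsf{left})\qquad \text{from } \{\Delta,\Gamma\Rightarrow\Pi\}_{\Delta\in|\forall X.\varphi|_0}\ \text{ infer }\ \forall X.\varphi,\Gamma\Rightarrow\Pi$$ is not sound; that is, there are a language, a Heyting-valued structure $\mathcal{M}$ for it, a valuation $\mathcal{V}$ on $\mathcal{M}$ and an instance of the rule (with $\forall X.\varphi\in\mathsf{FMP}_0$) such that $\mathcal{V}(\Delta\cup\Gamma)\le\mathcal{V}(\Pi)$ for every $\Delta\in|\forall X.\varphi|_0$, but $\mathcal{V}(\{\forall X.\varphi\}\cup\Gamma)\not\le\mathcal{V}(\Pi)$.
   Context: **Syntax.** Given a language of first order function and predicate symbols, countably many term variables and countably many (unary) set variables $X,Y,\dots$; $\mathsf{Tm}$ is the set of terms. $\mathsf{FM}$ is the set of second order formulas $\varphi,\psi ::= p(\vec t)\mid X(t)\mid\bot\mid\varphi\star\psi\mid Qx.\varphi\mid QX.\varphi$ ($\star\in\{\wedge,\vee,\rightarrow\}$, $Q\in\{\forall,\exists\}$); $\mathsf{Fm}$ is the subset of formulas without second order quantifiers. $\mathsf{FMP}_0$ is given by the grammar of $\mathsf{Fm}$ plus $QX.\xi$ with $\xi\in\mathsf{Fm}$ whose free set variables are among $\{X\}$. $\mathsf{FV}$ denotes free set variables. $\mathbf{LI}$ is the ordinary single-conclusion sequent calculus for first order intuitionistic logic on $\mathsf{Fm}$ (set variables behave as unary predicate symbols), with sequents $\Gamma\Rightarrow\Pi$, $\Gamma$ a finite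 set of formulas, $\Pi$ empty or a singleton; $\vdash^{cf}$ is cut-free derivability. $|\forall X.\varphi|_0$ is the set of finite sets $\Delta\subseteq\mathsf{Fm}$ such that $\mathbf{LI}\vdash^{cf}\Delta\Rightarrow\varphi(Y)$ for some $Y\notin\mathsf{FV}(\Delta)$. **Semantics.** A Heyting-valued prestructure consists of a complete Heyting algebra $\mathbf{A}$, the term domain $\mathsf{Tm}$ (only term models are considered: function symbols are interpreted as term constructors), a nonempty $\mathcal{D}\subseteq\mathbf{A}^{\mathsf{Tm}}$, and for each $n$-ary predicate symbol $p$ a function $p^{\mathcal{M}}:\mathsf{Tm}^n\to\mathbf{A}$. A valuation $\mathcal{V}$ maps set variables to $\mathcal{D}$ and extends to formulas by $\mathcal{V}(p(\vec t))=p^{\mathcal{M}}(\vec t)$, $\mathcal{V}(X(t))=\mathcal{V}(X)(t)$, $\mathcal{V}(\bot)=\bot$, $\mathcal{V}(\varphi\star\psi)=\mathcal{V}(\varphi)\star\mathcal{V}(\psi)$, $\mathcal{V}(\forall x.\varphi(x))=\bigwedge_{t\in\mathsf{Tm}}\mathcal{V}(\varphi(t))$, $\mathcal{V}(\exists x.\varphi(x))=\bigvee_{t\in\mathsf{Tm}}\mathcal{V}(\varphi(t))$, $\mathcal{V}(\forall X.\varphi)=\bigwedge_{F\in\mathcal{D}}\mathcal{V}[F/X](\varphi)$, $\mathcal{V}(\exists X.\varphi)=\bigvee_{F\in\mathcal{D}}\mathcal{V}[F/X](\varphi)$. The prestructure is a Heyting-valued structure if for every valuation $\mathcal{V}$ and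 every abstract $\lambda x.\varphi$ ($\varphi\in\mathsf{FM}$), the function $t\mapsto\mathcal{V}(\varphi(t))$ belongs to $\mathcal{D}$. For a finite set $\Gamma$, $\mathcal{V}(\Gamma)=\bigwedge_{\psi\in\Gamma}\mathcal{V}(\psi)$; for a right-hand side $\Pi$, $\mathcal{V}(\Pi)=\bigvee_{\psi\in\Pi}\mathcal{V}(\psi)$. -}

module Defs where

import Data.Empty as Empty
open import Data.List.Base using (List; []; _∷_; _++_; map; foldr)
open import Data.List.Relation.Binary.Subset.Propositional using (_⊆_)
open import Data.List.Relation.Unary.All using (All)
open import Data.Maybe.Base as Maybe using (Maybe; just; nothing; maybe′)
open import Data.Nat.Base using (ℕ; zero; suc)
open import Data.Product.Base using (_×_; ∃-syntax)
open import Data.Sum.Base using (_⊎_)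
open import Data.Vec.Base using (Vec; []; _∷_)
open import Level using (Level; 0ℓ; _⊔_) renaming (suc to lsuc)
open import Relation.Binary.Lattice.Bundles using (HeytingAlgebra)
open import Relation.Binary.PropositionalEquality.Core using (_≡_)
open import Relation.Nullary.Negation.Core using (¬_)
open import Relation.Unary using (Pred)

------------------------------------------------------------------------
-- Syntax

record Language : Set₁ where
  field
    Fun  : Set
    Rel  : Set
    arᶠ  : Fun → ℕ
    arʳ  : Rel → ℕ

-- Term variables and set variables are de Bruijn indices, in two separate
-- name spaces.  Indices are not bounded by a context: those pointing beyond
-- the enclosing binders are the countably many free variables.

data Tm (L : Language) : Set where
  var : ℕ → Tm L
  fun : (f : Language.Fun L) → Vec (Tm L) (Language.arᶠ L f) → Tm L

data Order : Set where
  first second : Order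

infixr 7 _∧ᶠ_
infixr 6 _∨ᶠ_
infixr 5 _→ᶠ_
infix  8 ∀¹_ ∃¹_ ∀²_ ∃²_

data Formula (L : Language) : Order → Set where
  rel            : ∀ {o} (p : Language.Rel L) → Vec (Tm L) (Language.arʳ L p) → Formula L o
  set            : ∀ {o} → ℕ → Tm L → Formula L o          -- X(t)
  ⊥ᶠ             : ∀ {o} → Formula L o
  _∧ᶠ_ _∨ᶠ_ _→ᶠ_ : ∀ {o} → Formula L o → Formula L o → Formula L o
  ∀¹_ ∃¹_        : ∀ {o} → Formula L o → Formula L o       -- bind a term variable
  ∀²_ ∃²_        : Formula L second → Formula L second     -- bind a set variable

Fm FM : Language → Set
Fm L = Formula L first
FM L = Formula L second

-- The inclusion Fm ⊆ FM.
⌈_⌉ : ∀ {L} → Fm L → FM L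
⌈ rel p ts ⌉ = rel p ts
⌈ set X t ⌉  = set X t
⌈ ⊥ᶠ ⌉       = ⊥ᶠ
⌈ φ ∧ᶠ ψ ⌉   = ⌈ φ ⌉ ∧ᶠ ⌈ ψ ⌉
⌈ φ ∨ᶠ ψ ⌉   = ⌈ φ ⌉ ∨ᶠ ⌈ ψ ⌉
⌈ φ →ᶠ ψ ⌉   = ⌈ φ ⌉ →ᶠ ⌈ ψ ⌉
⌈ ∀¹ φ ⌉     = ∀¹ ⌈ φ ⌉
⌈ ∃¹ φ ⌉     = ∃¹ ⌈ φ ⌉

-- X ∈FV φ : the set variable X occurs free in φ.
_∈FV_ : ∀ {L o} → ℕ → Formula L o → Set
X ∈FV rel p ts = Empty.⊥
X ∈FV set Y t  = X ≡ Y
X ∈FV ⊥ᶠ       = Empty.⊥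
X ∈FV (φ ∧ᶠ ψ) = X ∈FV φ ⊎ X ∈FV ψ
X ∈FV (φ ∨ᶠ ψ) = X ∈FV φ ⊎ X ∈FV ψ
X ∈FV (φ →ᶠ ψ) = X ∈FV φ ⊎ X ∈FV ψ
X ∈FV (∀¹ φ)   = X ∈FV φ
X ∈FV (∃¹ φ)   = X ∈FV φ
X ∈FV (∀² φ)   = suc X ∈FV φ
X ∈FV (∃² φ)   = suc X ∈FV φ

-- In QX.ξ the bound X is index 0 of ξ, so FV(ξ) ⊆ {X} says that 0 is the
-- only set variable free in ξ.
data FMP₀ {L : Language} : FM L → Set where
  rel  : ∀ p ts → FMP₀ (rel p ts)
  set  : ∀ X t → FMP₀ (set X t)
  ⊥ᶠ   : FMP₀ ⊥ᶠ
  _∧ᶠ_ : ∀ {φ ψ} → FMP₀ φ → FMP₀ ψ → FMP₀ (φ ∧ᶠ ψ)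
  _∨ᶠ_ : ∀ {φ ψ} → FMP₀ φ → FMP₀ ψ → FMP₀ (φ ∨ᶠ ψ)
  _→ᶠ_ : ∀ {φ ψ} → FMP₀ φ → FMP₀ ψ → FMP₀ (φ →ᶠ ψ)
  ∀¹_  : ∀ {φ} → FMP₀ φ → FMP₀ (∀¹ φ)
  ∃¹_  : ∀ {φ} → FMP₀ φ → FMP₀ (∃¹ φ)
  ∀²₀  : (ξ : Fm L) → (∀ X → X ∈FV ξ → X ≡ 0) → FMP₀ (∀² ⌈ ξ ⌉)
  ∃²₀  : (ξ : Fm L) → (∀ X → X ∈FV ξ → X ≡ 0) → FMP₀ (∃² ⌈ ξ ⌉)

------------------------------------------------------------------------
-- Substitution

infixr 5 _•_

-- a • s sends index 0 to a and shifts s by one.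
_•_ : ∀ {a} {A : Set a} → A → (ℕ → A) → (ℕ → A)
(a • s) zero    = a
(a • s) (suc n) = s n

mutual
  _[_]ᵗ : ∀ {L} → Tm L → (ℕ → Tm L) → Tm L
  var x    [ σ ]ᵗ = σ x
  fun f ts [ σ ]ᵗ = fun f (ts [ σ ]ᵗˢ)

  _[_]ᵗˢ : ∀ {L n} → Vec (Tm L) n → (ℕ → Tm L) → Vec (Tm L) n
  []       [ σ ]ᵗˢ = []
  (t ∷ ts) [ σ ]ᵗˢ = t [ σ ]ᵗ ∷ ts [ σ ]ᵗˢ

↑ : ∀ {L} → ℕ → Tm L
↑ n = var (suc n)

lift : ∀ {L} → (ℕ → Tm L) → (ℕ → Tm L)
lift σ = var 0 • λ n → σ n [ ↑ ]ᵗ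

-- Simultaneous substitution of terms for term variables.
_[_] : ∀ {L o} → Formula L o → (ℕ → Tm L) → Formula L o
rel p ts [ σ ] = rel p (ts [ σ ]ᵗˢ)
set X t  [ σ ] = set X (t [ σ ]ᵗ)
⊥ᶠ       [ σ ] = ⊥ᶠ
(φ ∧ᶠ ψ) [ σ ] = φ [ σ ] ∧ᶠ ψ [ σ ]
(φ ∨ᶠ ψ) [ σ ] = φ [ σ ] ∨ᶠ ψ [ σ ]
(φ →ᶠ ψ) [ σ ] = φ [ σ ] →ᶠ ψ [ σ ]
(∀¹ φ)   [ σ ] = ∀¹ (φ [ lift σ ])
(∃¹ φ)   [ σ ] = ∃¹ (φ [ lift σ ])
(∀² φ)   [ σ ] = ∀² (φ [ σ ])
(∃² φ)   [ σ ] = ∃² (φ [ σ ])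

-- φ(t), where the argument place is index 0.
_⟨_⟩ : ∀ {L o} → Formula L o → Tm L → Formula L o
φ ⟨ t ⟩ = φ [ t • var ]

wk : ∀ {L o} → Formula L o → Formula L o
wk φ = φ [ ↑ ]

-- Renaming of set variables; first order formulas do not bind them.
renameˢ : ∀ {L} → (ℕ → ℕ) → Fm L → Fm L
renameˢ r (rel p ts) = rel p ts
renameˢ r (set X t)  = set (r X) t
renameˢ r ⊥ᶠ         = ⊥ᶠ
renameˢ r (φ ∧ᶠ ψ)   = renameˢ r φ ∧ᶠ renameˢ r ψ
renameˢ r (φ ∨ᶠ ψ)   = renameˢ r φ ∨ᶠ renameˢ r ψ
renameˢ r (φ →ᶠ ψ)   = renameˢ r φ →ᶠ renameˢ r ψ
renameˢ r (∀¹ φ)     = ∀¹ renameˢ r φ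
renameˢ r (∃¹ φ)     = ∃¹ renameˢ r φ

-- φ(Y), for the body φ of ∀X.φ.
_⟨_⟩ˢ : ∀ {L} → Fm L → ℕ → Fm L
φ ⟨ Y ⟩ˢ = renameˢ (Y • λ n → n) φ

------------------------------------------------------------------------
-- Cut-free LI

-- Finite sets of formulas are lists; `struct` makes derivability depend only
-- on the underlying set (exchange, contraction) and gives left weakening.
-- Shifting the side formulas with wk in ∀R and ∃L makes index 0 a variable
-- not free in the conclusion, which is the eigenvariable condition.

infix 3 _⊢ᶜᶠ_

data _⊢ᶜᶠ_ {L : Language} : List (Fm L) → Maybe (Fm L) → Set where
  id     : ∀ {φ} → φ ∷ [] ⊢ᶜᶠ just φ
  struct : ∀ {Γ Γ′ Π} → Γ ⊆ Γ′ → Γ ⊢ᶜᶠ Π → Γ′ ⊢ᶜᶠ Π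
  weakR  : ∀ {Γ φ} → Γ ⊢ᶜᶠ nothing → Γ ⊢ᶜᶠ just φ
  ⊥L     : ∀ {Π} → ⊥ᶠ ∷ [] ⊢ᶜᶠ Π
  ∧L     : ∀ {Γ Π φ ψ} → φ ∷ ψ ∷ Γ ⊢ᶜᶠ Π → (φ ∧ᶠ ψ) ∷ Γ ⊢ᶜᶠ Π
  ∧R     : ∀ {Γ φ ψ} → Γ ⊢ᶜᶠ just φ → Γ ⊢ᶜᶠ just ψ → Γ ⊢ᶜᶠ just (φ ∧ᶠ ψ)
  ∨L     : ∀ {Γ Π φ ψ} → φ ∷ Γ ⊢ᶜᶠ Π → ψ ∷ Γ ⊢ᶜᶠ Π → (φ ∨ᶠ ψ) ∷ Γ ⊢ᶜᶠ Π
  ∨R₁    : ∀ {Γ φ ψ} → Γ ⊢ᶜᶠ just φ → Γ ⊢ᶜᶠ just (φ ∨ᶠ ψ)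
  ∨R₂    : ∀ {Γ φ ψ} → Γ ⊢ᶜᶠ just ψ → Γ ⊢ᶜᶠ just (φ ∨ᶠ ψ)
  →L     : ∀ {Γ Π φ ψ} → Γ ⊢ᶜᶠ just φ → ψ ∷ Γ ⊢ᶜᶠ Π → (φ →ᶠ ψ) ∷ Γ ⊢ᶜᶠ Π
  →R     : ∀ {Γ φ ψ} → φ ∷ Γ ⊢ᶜᶠ just ψ → Γ ⊢ᶜᶠ just (φ →ᶠ ψ)
  ∀L     : ∀ {Γ Π φ} t → φ ⟨ t ⟩ ∷ Γ ⊢ᶜᶠ Π → (∀¹ φ) ∷ Γ ⊢ᶜᶠ Π
  ∀R     : ∀ {Γ φ} → map wk Γ ⊢ᶜᶠ just φ → Γ ⊢ᶜᶠ just (∀¹ φ)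
  ∃L     : ∀ {Γ Π φ} → φ ∷ map wk Γ ⊢ᶜᶠ Maybe.map wk Π → (∃¹ φ) ∷ Γ ⊢ᶜᶠ Π
  ∃R     : ∀ {Γ φ} t → Γ ⊢ᶜᶠ just (φ ⟨ t ⟩) → Γ ⊢ᶜᶠ just (∃¹ φ)

∣∀²_∣₀ : ∀ {L} → Fm L → Pred (List (Fm L)) 0ℓ
∣∀² φ ∣₀ Δ = ∃[ Y ] All (λ ψ → ¬ (Y ∈FV ψ)) Δ × (Δ ⊢ᶜᶠ just (φ ⟨ Y ⟩ˢ))

------------------------------------------------------------------------
-- Complete Heyting algebras

-- Predicatively, a nontrivial lattice with all joins of families indexed by
-- types in Set ι has to live in a larger universe c.  The small set of
-- generators keeps such a lattice from being a proper class in disguise: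
-- every element is determined by the generators below it.  When c = ι the
-- generators can be all elements, and classically a set-generated lattice
-- embeds in the powerset of Generator, so that it also has the joins and
-- meets of all its subsets, i.e. is a complete Heyting algebra in the usual
-- sense.

record CompleteHeytingAlgebra (c ℓ ι : Level) : Set (lsuc (c ⊔ ℓ ⊔ ι)) where
  field
    heytingAlgebra : HeytingAlgebra c ℓ ι

  open HeytingAlgebra heytingAlgebra public

  field
    ⋁ ⋀        : {I : Set ι} → (I → Carrier) → Carrier
    ⋁-upper    : {I : Set ι} (f : I → Carrier) → ∀ i → f i ≤ ⋁ f
    ⋁-least    : {I : Set ι} (f : I → Carrier) → ∀ a → (∀ i → f i ≤ a) → ⋁ f ≤ a
    ⋀-lower    : {I : Set ι} (f : I → Carrier) → ∀ i → ⋀ f ≤ f i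
    ⋀-greatest : {I : Set ι} (f : I → Carrier) → ∀ a → (∀ i → a ≤ f i) → a ≤ ⋀ f

    Generator  : Set ι
    gen        : Generator → Carrier
    generated  : ∀ a b → (∀ g → gen g ≤ a → gen g ≤ b) → a ≤ b

------------------------------------------------------------------------
-- Heyting-valued structures

record HeytingValuedPrestructure (L : Language) (c ℓ : Level) : Set (lsuc (c ⊔ ℓ)) where
  field
    algebra : CompleteHeytingAlgebra c ℓ 0ℓ

  open CompleteHeytingAlgebra algebra public

  -- The set 𝒟 of functions Tm → 𝐀 is the image of the family ext.
  field
    𝒟          : Set
    ext        : 𝒟 → Tm L → Carrier
    𝒟-nonempty : 𝒟
    relᴹ       : (p : Language.Rel L) → Vec (Tm L) (Language.arʳ L p) → Carrier

  Valuation : Set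
  Valuation = ℕ → 𝒟

  -- value 𝒱 σ φ is 𝒱(φ[σ]): carrying σ along makes the clauses for Qx, where
  -- φ(t) ranges over all instances of the body, structurally recursive.
  value : ∀ {o} → Valuation → (ℕ → Tm L) → Formula L o → Carrier
  value 𝒱 σ (rel p ts) = relᴹ p (ts [ σ ]ᵗˢ)
  value 𝒱 σ (set X t)  = ext (𝒱 X) (t [ σ ]ᵗ)
  value 𝒱 σ ⊥ᶠ         = ⊥
  value 𝒱 σ (φ ∧ᶠ ψ)   = value 𝒱 σ φ ∧ value 𝒱 σ ψ
  value 𝒱 σ (φ ∨ᶠ ψ)   = value 𝒱 σ φ ∨ value 𝒱 σ ψ
  value 𝒱 σ (φ →ᶠ ψ)   = value 𝒱 σ φ ⇨ value 𝒱 σ ψ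
  value 𝒱 σ (∀¹ φ)     = ⋀ λ (t : Tm L) → value 𝒱 (t • σ) φ
  value 𝒱 σ (∃¹ φ)     = ⋁ λ (t : Tm L) → value 𝒱 (t • σ) φ
  value 𝒱 σ (∀² φ)     = ⋀ λ (F : 𝒟) → value (F • 𝒱) σ φ
  value 𝒱 σ (∃² φ)     = ⋁ λ (F : 𝒟) → value (F • 𝒱) σ φ

  ⟦_⟧ : FM L → Valuation → Carrier
  ⟦ φ ⟧ 𝒱 = value 𝒱 var φ

  ⟦_⟧ᴸ : List (FM L) → Valuation → Carrier
  ⟦ Γ ⟧ᴸ 𝒱 = foldr (λ ψ a → ⟦ ψ ⟧ 𝒱 ∧ a) ⊤ Γ

  ⟦_⟧ᴿ : Maybe (FM L) → Valuation → Carrier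
  ⟦ Π ⟧ᴿ 𝒱 = maybe′ (λ ψ → ⟦ ψ ⟧ 𝒱) ⊥ Π

record HeytingValuedStructure (L : Language) (c ℓ : Level) : Set (lsuc (c ⊔ ℓ)) where
  field
    prestructure : HeytingValuedPrestructure L c ℓ

  open HeytingValuedPrestructure prestructure public

  -- t ↦ 𝒱(φ(t)) belongs to 𝒟.
  field
    comprehension : ∀ (𝒱 : Valuation) (φ : FM L) →
                    ∃[ F ] (∀ t → ext F t ≈ value 𝒱 (t • var) φ)

{-# OPTIONS --safe #-}

-- Interpret formulas as types, ≤ being implication, and let 𝒟 consist of the
-- constant functions with value ⊤ or ⊥.  In the empty language every formula
-- then takes a constant value, ⊤ or ⊥, so comprehension holds.  For
-- φ = X(x₀) → X(x₁), the formula ∀X.φ is true because every member of 𝒟 is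
-- constant.  But if Δ ⇒ φ(Y) is derivable with Y not free in Δ, then Δ is
-- false: Δ is first order, so its value is unaffected by reinterpreting Y as
-- {x₀}, which is not in 𝒟 and falsifies φ(Y).  Hence Γ = Π = ∅ refutes the rule.

module Submission where

open import Defs
open import Data.Bool.Base using (Bool; true; false; T; _∧_; _∨_; not)
open import Data.Empty using (⊥; ⊥-elim)
open import Data.List.Base using (List; []; _∷_; _++_; map)
open import Data.List.Relation.Unary.All as All using (All; []; _∷_)
open import Data.List.Relation.Unary.All.Properties using (anti-mono; map⁺)
open import Data.Maybe.Base as Maybe using (Maybe; just; nothing; maybe′)
open import Data.Maybe.Relation.Unary.All using (nothing) renaming (All to Allᴹ)
open import Data.Nat.Base using (ℕ)
open import Data.Product.Base using (Σ; Σ-syntax; _×_; _,_; proj₁; proj₂; <_,_>; curry; uncurry; swap)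
open import Data.Product.Function.NonDependent.Propositional using (_×-⇔_)
open import Data.Sum.Base using (_⊎_; inj₁; inj₂; [_,_])
open import Data.Sum.Function.Propositional using (_⊎-⇔_)
open import Data.Unit.Base using (⊤; tt)
open import Function.Base using (_∘_; _∘′_; const) renaming (id to identity)
open import Function.Bundles using (_⇔_; mk⇔; Equivalence)
open import Function.Properties.Equivalence using () renaming (refl to ⇔-refl)
open import Function.Related.TypeIsomorphisms using (→-cong-⇔)
open import Level using (0ℓ; suc)
open import Relation.Binary.Lattice.Bundles using (HeytingAlgebra)
open import Relation.Binary.PropositionalEquality using (_≡_; refl; trans)
open import Relation.Nullary.Negation.Core using (¬_; contradiction)
open import Relation.Nullary.Reflects
  using (Reflects; ofʸ; ofⁿ; fromEquivalence; T-reflects; _×-reflects_; _⊎-reflects_; _→-reflects_)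
open import Relation.Unary using (_∈_)

open Equivalence using (to; from)

Π-cong-⇔ : {I : Set} {A B : I → Set} → (∀ i → A i ⇔ B i) → (∀ i → A i) ⇔ (∀ i → B i)
Π-cong-⇔ e = mk⇔ (λ f i → to (e i) (f i)) (λ f i → from (e i) (f i))

Σ-cong-⇔ : {I : Set} {A B : I → Set} → (∀ i → A i ⇔ B i) → Σ I A ⇔ Σ I B
Σ-cong-⇔ e = mk⇔ (λ (i , a) → i , to (e i) a) (λ (i , b) → i , from (e i) b)

types : HeytingAlgebra (suc 0ℓ) 0ℓ 0ℓ
types = record
  { Carrier = Set
  ; _≈_ = λ A B → (A → B) × (B → A)
  ; _≤_ = λ A B → A → B
  ; _∨_ = _⊎_
  ; _∧_ = _×_
  ; _⇨_ = λ A B → A → B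
  ; ⊤ = ⊤
  ; ⊥ = ⊥
  ; isHeytingAlgebra = record
    { isBoundedLattice = record
      { isLattice = record
        { isPartialOrder = record
          { isPreorder = record
            { isEquivalence = record
              { refl = identity , identity
              ; sym = swap
              ; trans = λ (f , f′) (g , g′) → g ∘ f , f′ ∘ g′
              }
            ; reflexive = proj₁
            ; trans = λ f g → g ∘ f
            }
          ; antisym = _,_
          }
        ; supremum = λ _ _ → inj₁ , inj₂ , λ _ f g → [ f , g ]
        ; infimum = λ _ _ → proj₁ , proj₂ , λ _ f g → < f , g >
        }
      ; maximum = λ _ _ → tt
      ; minimum = λ _ → ⊥-elim
      }
    ; exponential = λ _ _ _ → curry , uncurry
    }
  }

completeTypes : CompleteHeytingAlgebra (suc 0ℓ) 0ℓ 0ℓ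
completeTypes = record
  { heytingAlgebra = types
  ; ⋁ = Σ _
  ; ⋀ = λ f → ∀ i → f i
  ; ⋁-upper = λ _ → _,_
  ; ⋁-least = λ _ _ → uncurry
  ; ⋀-lower = λ _ i a → a i
  ; ⋀-greatest = λ _ _ h a i → h i a
  -- Up to logical equivalence a type is determined by whether `⊤` maps into it, so one generator
  -- suffices.
  ; Generator = ⊤
  ; gen = λ _ → ⊤
  ; generated = λ _ _ h a → h tt (const a) tt
  }

∅ : Language
∅ = record { Fun = ⊥ ; Rel = ⊥ ; arᶠ = λ () ; arʳ = λ () }

typeValued : (𝒟 : Set) → 𝒟 → (𝒟 → Tm ∅ → Set) → HeytingValuedPrestructure ∅ (suc 0ℓ) 0ℓ
typeValued 𝒟 F ext = record
  { algebra = completeTypes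
  ; 𝒟 = 𝒟
  ; ext = ext
  ; 𝒟-nonempty = F
  ; relᴹ = λ ()
  }

-- `∅` has no function symbols, so every term is a variable.
[]ᵗ-∘ : ∀ t {τ σ ρ : ℕ → Tm ∅} → (∀ n → τ n [ σ ]ᵗ ≡ ρ n) → t [ τ ]ᵗ [ σ ]ᵗ ≡ t [ ρ ]ᵗ
[]ᵗ-∘ (var n) eq = eq n

↑-• : ∀ t {u} {σ : ℕ → Tm ∅} → t [ ↑ ]ᵗ [ u • σ ]ᵗ ≡ t [ σ ]ᵗ
↑-• t = []ᵗ-∘ t λ _ → refl

-- Second order variables X range over ℕ = 𝒟 under the identity valuation, so
-- that E is an arbitrary assignment of predicates to set variables.
module FirstOrder (E : ℕ → Tm ∅ → Set) where

  open HeytingValuedPrestructure (typeValued ℕ 0 E) using (value)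

  Holds : (ℕ → Tm ∅) → Fm ∅ → Set
  Holds = value identity

  -- The composite is any `ρ` that agrees with it pointwise, a form that passes under quantifiers:
  -- there `lift τ` followed by `t • σ` agrees pointwise with `t • ρ`.
  Holds-[] : ∀ φ {τ σ ρ : ℕ → Tm ∅} → (∀ n → τ n [ σ ]ᵗ ≡ ρ n) →
             Holds σ (φ [ τ ]) ⇔ Holds ρ φ
  Holds-[] (set X t) {τ} {σ} {ρ} eq rewrite []ᵗ-∘ t {τ} {σ} {ρ} eq = ⇔-refl
  Holds-[] ⊥ᶠ        eq = ⇔-refl
  Holds-[] (φ ∧ᶠ ψ)  eq = Holds-[] φ eq ×-⇔ Holds-[] ψ eq
  Holds-[] (φ ∨ᶠ ψ)  eq = Holds-[] φ eq ⊎-⇔ Holds-[] ψ eq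
  Holds-[] (φ →ᶠ ψ)  eq = →-cong-⇔ (Holds-[] φ eq) (Holds-[] ψ eq)
  Holds-[] (∀¹ φ) {τ} eq = Π-cong-⇔ λ t → Holds-[] φ
    λ { ℕ.zero → refl ; (ℕ.suc n) → trans (↑-• (τ n)) (eq n) }
  Holds-[] (∃¹ φ) {τ} eq = Σ-cong-⇔ λ t → Holds-[] φ
    λ { ℕ.zero → refl ; (ℕ.suc n) → trans (↑-• (τ n)) (eq n) }

  Holds-⟨⟩ : ∀ φ t {σ} → Holds σ (φ ⟨ t ⟩) ⇔ Holds (t [ σ ]ᵗ • σ) φ
  Holds-⟨⟩ φ t = Holds-[] φ λ { ℕ.zero → refl ; (ℕ.suc _) → refl }

  Holds-wk : ∀ φ {t σ} → Holds (t • σ) (wk φ) ⇔ Holds σ φ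
  Holds-wk φ = Holds-[] φ λ _ → refl

  Holdsᴿ : (ℕ → Tm ∅) → Maybe (Fm ∅) → Set
  Holdsᴿ σ = maybe′ (Holds σ) ⊥

  Holds-map-wk : ∀ {Γ t σ} → All (Holds σ) Γ → All (Holds (t • σ)) (map wk Γ)
  Holds-map-wk γ = map⁺ (All.map (λ {φ} → from (Holds-wk φ)) γ)

  Holdsᴿ-wk : ∀ Π {t σ} → Holdsᴿ (t • σ) (Maybe.map wk Π) → Holdsᴿ σ Π
  Holdsᴿ-wk (just φ) = to (Holds-wk φ)

  -- `σ` varies in the induction because `∀R` and `∃L` use their premise at `t • σ` for arbitrary
  -- `t`. No rule acts on set quantifiers, so `E` may assign any predicates.
  soundness : ∀ {Γ Π} → Γ ⊢ᶜᶠ Π → ∀ σ → All (Holds σ) Γ → Holdsᴿ σ Π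
  soundness id           σ (a ∷ [])       = a
  soundness (struct s d) σ γ              = soundness d σ (anti-mono s γ)
  soundness (weakR d)    σ γ              = ⊥-elim (soundness d σ γ)
  soundness ⊥L           σ (() ∷ [])
  soundness (∧L d)       σ ((a , b) ∷ γ)  = soundness d σ (a ∷ b ∷ γ)
  soundness (∧R d e)     σ γ              = soundness d σ γ , soundness e σ γ
  soundness (∨L d e)     σ (inj₁ a ∷ γ)   = soundness d σ (a ∷ γ)
  soundness (∨L d e)     σ (inj₂ b ∷ γ)   = soundness e σ (b ∷ γ)
  soundness (∨R₁ d)      σ γ              = inj₁ (soundness d σ γ)
  soundness (∨R₂ d)      σ γ              = inj₂ (soundness d σ γ)
  soundness (→L d e)     σ (f ∷ γ)        = soundness e σ (f (soundness d σ γ) ∷ γ)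
  soundness (→R d)       σ γ              = λ a → soundness d σ (a ∷ γ)
  soundness (∀L {φ = φ} t d) σ (f ∷ γ)    =
    soundness d σ (from (Holds-⟨⟩ φ t) (f (t [ σ ]ᵗ)) ∷ γ)
  soundness (∀R d)       σ γ              = λ t → soundness d (t • σ) (Holds-map-wk γ)
  soundness (∃L {Π = Π} d) σ ((t , a) ∷ γ) =
    Holdsᴿ-wk Π (soundness d (t • σ) (a ∷ Holds-map-wk γ))
  soundness (∃R {φ = φ} t d) σ γ          =
    t [ σ ]ᵗ , to (Holds-⟨⟩ φ t) (soundness d σ γ)

constants : HeytingValuedPrestructure ∅ (suc 0ℓ) 0ℓ
constants = typeValued Bool true (λ b _ → T b)

module C = HeytingValuedPrestructure constants
open C using (value)

-- Two-valued evaluation that never looks at terms: set variables denote constants, so first order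
-- quantifiers are vacuous.
truth : ∀ {o} → C.Valuation → Formula ∅ o → Bool
truth 𝒱 (set X t) = 𝒱 X
truth 𝒱 ⊥ᶠ        = false
truth 𝒱 (φ ∧ᶠ ψ)  = truth 𝒱 φ ∧ truth 𝒱 ψ
truth 𝒱 (φ ∨ᶠ ψ)  = truth 𝒱 φ ∨ truth 𝒱 ψ
truth 𝒱 (φ →ᶠ ψ)  = not (truth 𝒱 φ) ∨ truth 𝒱 ψ
truth 𝒱 (∀¹ φ)    = truth 𝒱 φ
truth 𝒱 (∃¹ φ)    = truth 𝒱 φ
truth 𝒱 (∀² φ)    = truth (true • 𝒱) φ ∧ truth (false • 𝒱) φ
truth 𝒱 (∃² φ)    = truth (true • 𝒱) φ ∨ truth (false • 𝒱) φ

Reflects-⇔ : ∀ {A B : Set} {b} → A ⇔ B → Reflects A b → Reflects B b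
Reflects-⇔ e (ofʸ a)  = ofʸ (to e a)
Reflects-⇔ e (ofⁿ ¬a) = ofⁿ (¬a ∘ from e)

T⇔Reflected : ∀ {A : Set} {b} → Reflects A b → T b ⇔ A
T⇔Reflected (ofʸ a)  = mk⇔ (const a) (const tt)
T⇔Reflected (ofⁿ ¬a) = mk⇔ ⊥-elim ¬a

-- The deciding Boolean does not mention `σ`, which is the source of comprehension. Set quantifiers
-- reduce to the two members of `Bool`.
truth-reflects : ∀ {o} (φ : Formula ∅ o) 𝒱 σ → Reflects (value 𝒱 σ φ) (truth 𝒱 φ)
truth-reflects (set X t) 𝒱 σ = T-reflects (𝒱 X)
truth-reflects ⊥ᶠ        𝒱 σ = ofⁿ identity
truth-reflects (φ ∧ᶠ ψ)  𝒱 σ = truth-reflects φ 𝒱 σ ×-reflects truth-reflects ψ 𝒱 σ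
truth-reflects (φ ∨ᶠ ψ)  𝒱 σ = truth-reflects φ 𝒱 σ ⊎-reflects truth-reflects ψ 𝒱 σ
truth-reflects (φ →ᶠ ψ)  𝒱 σ = truth-reflects φ 𝒱 σ →-reflects truth-reflects ψ 𝒱 σ
truth-reflects (∀¹ φ)    𝒱 σ = fromEquivalence
  (λ b t → to (T⇔Reflected (truth-reflects φ 𝒱 (t • σ))) b)
  -- Any term would do in place of `var 0`, since all instances have the same truth value.
  (λ f → from (T⇔Reflected (truth-reflects φ 𝒱 (var 0 • σ))) (f (var 0)))
truth-reflects (∃¹ φ)    𝒱 σ = fromEquivalence
  (λ b → var 0 , to (T⇔Reflected (truth-reflects φ 𝒱 (var 0 • σ))) b)
  (λ (t , a) → from (T⇔Reflected (truth-reflects φ 𝒱 (t • σ))) a)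
truth-reflects (∀² φ)    𝒱 σ = Reflects-⇔
  (mk⇔ (λ { (a , b) true → a ; (a , b) false → b }) (λ f → f true , f false))
  (truth-reflects φ (true • 𝒱) σ ×-reflects truth-reflects φ (false • 𝒱) σ)
truth-reflects (∃² φ)    𝒱 σ = Reflects-⇔
  (mk⇔ [ true ,_ , false ,_ ] (λ { (true , a) → inj₁ a ; (false , b) → inj₂ b }))
  (truth-reflects φ (true • 𝒱) σ ⊎-reflects truth-reflects φ (false • 𝒱) σ)

constantStructure : HeytingValuedStructure ∅ (suc 0ℓ) 0ℓ
constantStructure = record
  { prestructure = constants
  -- The Boolean is computed without `t`, so it codes a constant function.
  ; comprehension = λ 𝒱 φ → truth 𝒱 φ , λ t →
      let e = T⇔Reflected (truth-reflects φ 𝒱 (t • var)) in to e , from e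
  }

-- On `Fm` both semantics have the same clauses, so only the atoms matter. Hence `Y` can be
-- reinterpreted outside `𝒟` without affecting formulas in which it is not free.
value⇔Holds : ∀ {𝒱 E} (φ : Fm ∅) → (∀ X → X ∈FV φ → ∀ t → T (𝒱 X) ⇔ E X t) →
              ∀ {σ} → value 𝒱 σ ⌈ φ ⌉ ⇔ FirstOrder.Holds E σ φ
value⇔Holds (set X t) h = h X refl _
value⇔Holds ⊥ᶠ        h = ⇔-refl
value⇔Holds (φ ∧ᶠ ψ)  h =
  value⇔Holds φ (λ X → h X ∘′ inj₁) ×-⇔ value⇔Holds ψ (λ X → h X ∘′ inj₂)
value⇔Holds (φ ∨ᶠ ψ)  h =
  value⇔Holds φ (λ X → h X ∘′ inj₁) ⊎-⇔ value⇔Holds ψ (λ X → h X ∘′ inj₂)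
value⇔Holds (φ →ᶠ ψ)  h =
  →-cong-⇔ (value⇔Holds φ (λ X → h X ∘′ inj₁)) (value⇔Holds ψ (λ X → h X ∘′ inj₂))
value⇔Holds (∀¹ φ)    h = Π-cong-⇔ λ _ → value⇔Holds φ h
value⇔Holds (∃¹ φ)    h = Σ-cong-⇔ λ _ → value⇔Holds φ h

⟦⟧ᴸ⇒All : ∀ {𝒱} Δ → C.⟦ map ⌈_⌉ Δ ++ [] ⟧ᴸ 𝒱 → All (λ ψ → value 𝒱 var ⌈ ψ ⌉) Δ
⟦⟧ᴸ⇒All []      _       = []
⟦⟧ᴸ⇒All (ψ ∷ Δ) (a , δ) = a ∷ ⟦⟧ᴸ⇒All Δ δ

-- Under `∀²` this is Leibniz equality of two distinct free term variables.
x₀≐x₁ : Fm ∅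
x₀≐x₁ = set 0 (var 0) →ᶠ set 0 (var 1)

∣∀²x₀≐x₁∣₀-false : ∀ Δ → Δ ∈ ∣∀² x₀≐x₁ ∣₀ → ¬ C.⟦ map ⌈_⌉ Δ ++ [] ⟧ᴸ (const false)
∣∀²x₀≐x₁∣₀-false Δ (Y , Y∉Δ , d) δ =
  contradiction
    -- `Y` holds of x₀ by `(refl , refl)`; the derived implication carries it to x₁, giving the
    -- absurd `var 1 ≡ var 0`.
    (proj₂ (soundness d var (All.zipWith (λ {ψ} → holds ψ) (Y∉Δ , ⟦⟧ᴸ⇒All Δ δ)) (refl , refl)))
    λ ()
  where
  E : ℕ → Tm ∅ → Set
  -- At `Y` this is {x₀}; elsewhere it is empty, in agreement with `const false`.
  E X t = X ≡ Y × t ≡ var 0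

  open FirstOrder E

  holds : ∀ ψ → ¬ (Y ∈FV ψ) × value (const false) var ⌈ ψ ⌉ → Holds var ψ
  holds ψ (Y∉ψ , a) =
    to (value⇔Holds ψ λ X X∈ψ t → mk⇔ ⊥-elim λ { (refl , _) → Y∉ψ X∈ψ }) a

proposition4p4 : Σ[ L ∈ Language ]
    Σ[ M ∈ HeytingValuedStructure L (suc 0ℓ) 0ℓ ]
    let open HeytingValuedStructure M in
    Σ[ 𝒱 ∈ Valuation ]
    Σ[ φ ∈ Fm L ] Σ[ Γ ∈ List (FM L) ] Σ[ Π ∈ Maybe (FM L) ]
    FMP₀ (∀² ⌈ φ ⌉) × All FMP₀ Γ × Allᴹ FMP₀ Π ×
    (∀ Δ → Δ ∈ ∣∀² φ ∣₀ → ⟦ map ⌈_⌉ Δ ++ Γ ⟧ᴸ 𝒱 ≤ ⟦ Π ⟧ᴿ 𝒱) ×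
    ¬ (⟦ (∀² ⌈ φ ⌉) ∷ Γ ⟧ᴸ 𝒱 ≤ ⟦ Π ⟧ᴿ 𝒱)
proposition4p4 =
  ∅ , constantStructure , const false , x₀≐x₁ , [] , nothing ,
  ∀²₀ x₀≐x₁ (λ _ → [ identity , identity ]) , [] , nothing ,
  ∣∀²x₀≐x₁∣₀-false ,
  -- Both atoms have the value `T b` when the bound variable denotes `b`, so the identity proves the
  -- implication; `tt` is for the empty `Γ`.
  λ h → h ((λ _ → identity) , tt)
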